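{- If $n$ is a prime power, then $\mathsf{D}_n^{\times}=\eta_n^{\times}=2n-1$.
   Context: A prime power is $n=p^e$ with $p$ prime and $e\ge 1$. For an integer $n\ge 2$: - $\mathsf{D}_n^{\times}$ is the smallest positive integer $\ell$ such that, from any given $\ell$ integers (repetitions allowed) all coprime to $n$, one can select some of them (a non-empty sub-multiset) whose sum $\sigma$ satisfies $\gcd(\sigma,n^2)=n$. - $\eta_n^{\times}$ is the smallest positive integer $\ell$ such that, from any given $\ell$ integers (repetitions allowed) all coprime to $n$, one can select at most $n$ of them (and at least one) whose sum $\sigma$ satisfies $\gcd(\sigma,n^2)=n$. -}

module Defs where

open import Data.Integer.Base as ℤ using (ℤ; +_; 0ℤ)
open import Data.Integer.Coprimality using (Coprime)
open import Data.Integer.GCD using (gcd)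
open import Data.List.Base using (List; length; foldr)
open import Data.List.Relation.Binary.Sublist.Propositional using (_⊆_)
open import Data.List.Relation.Unary.All using (All)
open import Data.Nat.Base using (ℕ; _^_; _≤_)
open import Data.Nat.Primality using (Prime)
open import Data.Nat.Properties using (≤-antisym)
open import Data.Product.Base using (∃-syntax; _×_; _,_)
open import Relation.Binary.PropositionalEquality using (_≡_)

PrimePower : ℕ → Set
PrimePower n = ∃[ p ] ∃[ e ] Prime p × 1 ≤ e × n ≡ p ^ e

sumℤ : List ℤ → ℤ
sumℤ = foldr ℤ._+_ 0ℤ

GoodSum : ℕ → List ℤ → Set
GoodSum n ys = gcd (sumℤ ys) (+ (n ^ 2)) ≡ + n

-- A finite multiset is represented by any list enumerating it, so that its
-- sub-multisets are given by the order-preserving sublists (_⊆_ is not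
-- inclusion of underlying sets: it respects multiplicities).

DProperty : ℕ → ℕ → Set
DProperty n ℓ =
  ∀ (xs : List ℤ) → length xs ≡ ℓ → All (λ x → Coprime x (+ n)) xs →
  ∃[ ys ] ys ⊆ xs × 1 ≤ length ys × GoodSum n ys

ηProperty : ℕ → ℕ → Set
ηProperty n ℓ =
  ∀ (xs : List ℤ) → length xs ≡ ℓ → All (λ x → Coprime x (+ n)) xs →
  ∃[ ys ] ys ⊆ xs × 1 ≤ length ys × length ys ≤ n × GoodSum n ys

IsSmallestPositive : (ℕ → Set) → ℕ → Set
IsSmallestPositive P ℓ = 1 ≤ ℓ × P ℓ × (∀ m → 1 ≤ m → P m → ℓ ≤ m)

smallestPositive-unique : ∀ {P k ℓ} → IsSmallestPositive P k →
                          IsSmallestPositive P ℓ → k ≡ ℓ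
smallestPositive-unique (1≤k , Pk , k-least) (1≤ℓ , Pℓ , ℓ-least) =
  ≤-antisym (k-least _ 1≤ℓ Pℓ) (ℓ-least _ 1≤k Pk)

-- The constants D and η are introduced through their graphs, since a total
-- function n ↦ Dₙ would presuppose that a suitable ℓ exists for every n.
-- The graphs are single-valued by smallestPositive-unique.

infix 4 D×[_]≡_ η×[_]≡_

D×[_]≡_ : ℕ → ℕ → Set
D×[ n ]≡ ℓ = IsSmallestPositive (DProperty n) ℓ

η×[_]≡_ : ℕ → ℕ → Set
η×[ n ]≡ ℓ = IsSmallestPositive (ηProperty n) ℓ

{-# OPTIONS --safe #-}
module Submission where

-- For n = p ^ e put f(s) = C(s + n - 1, n - 1) · C(s, n).  If p ∤ f(s), then
-- n ∣ s and p n ∤ s.  As f has degree 2n - 1, its iterated difference with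
-- steps a₁, …, a₂ₙ₋₁ is the constant C(2n - 1, n - 1) a₁ ⋯ a₂ₙ₋₁, which is
-- prime to p when all aᵢ are.  Hence p ∤ f(σ) for some subsum σ of the aᵢ.
-- A sub-multiset of more than n elements contains a block of at most n
-- elements with sum divisible by n, and either that block or its complement
-- again has a sum divisible by n but not by p n; this gives the bound for η.
-- The list of n - 1 ones and n - 1 minus ones shows optimality, since 0 is its
-- only subsum divisible by n.

open import Defs
open import Data.Empty using (⊥-elim)
open import Data.Fin.Base using (Fin; toℕ; fromℕ<)
open import Data.Fin.Properties using (pigeonhole; fromℕ<-injective; toℕ<n)
open import Data.Integer.Base as ℤ using (ℤ; +_; 0ℤ; 1ℤ; -1ℤ; ∣_∣; _⊖_; _%ℕ_; _/ℕ_)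
open import Data.Integer.Coprimality using (Coprime)
open import Data.Integer.DivMod using (a≡a%ℕn+[a/ℕn]*n; n%ℕd<d)
import Data.Integer.Divisibility.Signed as ℤ∣
import Data.Integer.Properties as ℤ
import Data.Integer.Solver as ℤSolver
open import Data.List.Base
  using (List; []; _∷_; _++_; length; map; take; drop; replicate)
open import Data.List.Properties
  using (length-++; length-take; length-drop; length-replicate; take-take; take++drop≡id; ++-assoc)
open import Data.List.Relation.Binary.Sublist.Propositional
  using (_⊆_; []; _∷_; _∷ʳ_; ⊆-refl; ⊆-trans)
open import Data.List.Relation.Binary.Sublist.Propositional.Properties using (++⁺; ++⁺ˡ; ++⁺ʳ)
open import Data.List.Relation.Unary.All as All using (All; []; _∷_)
import Data.List.Relation.Unary.All.Properties as All
open import Data.Nat.Base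
  using (ℕ; zero; suc; _+_; _*_; _∸_; _^_; _⊓_; _≤_; _<_; z≤n; s≤s; s≤s⁻¹;
         NonZero; >-nonZero; ≢-nonZero⁻¹; nonTrivial⇒n>1)
open import Data.Nat.Combinatorics
  using (_C_; nCk≡nC[n∸k]; nCn≡1; nC1≡n; k>n⇒nCk≡0; nCk+nC[k+1]≡[n+1]C[k+1])
import Data.Nat.Coprimality as ℕ
open import Data.Nat.Divisibility
  using (_∣_; _∤_; _∣?_; divides; ∣-trans; ∣-refl; _∣0; m∣m*n; n∣m*n; *-monoʳ-∣; *-cancelˡ-∣;
         ∣m+n∣m⇒∣n; ∣1⇒≡1; >⇒∤; ∣⇒≤)
import Data.Nat.GCD as ℕ
open import Data.Nat.ListAction using (sum)
open import Data.Nat.Primality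
  using (Prime; prime⇒irreducible; prime⇒nonZero; prime⇒nonTrivial; euclidsLemma; ¬prime[1])
open import Data.Nat.Properties
open import Data.Nat.Solver using (module +-*-Solver)
open import Data.Product.Base using (∃-syntax; _×_; _,_)
open import Data.Sum.Base using (inj₁; inj₂; [_,_]′)
open import Function.Base using (_∘_)
open import Relation.Binary.PropositionalEquality
open import Relation.Nullary using (¬_; yes; no; contradiction)

private
  variable
    p d c c′ m n : ℕ
    g h : ℕ → ℕ

-- Binomial coefficients

nC0≡1 : ∀ n → n C 0 ≡ 1
nC0≡1 n = trans (nCk≡nC[n∸k] {0} {n} z≤n) (nCn≡1 n)

-- Pascal's rule carries the induction. The identity is what turns divisibility statements about
-- binomial coefficients into statements about their arguments.
absorption : ∀ n k → suc k * (suc n C suc k) ≡ suc n * (n C k)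
absorption n       zero    = begin
  1 * (suc n C 1)    ≡⟨ *-identityˡ _ ⟩
  suc n C 1          ≡⟨ nC1≡n (suc n) ⟩
  suc n              ≡⟨ *-identityʳ _ ⟨
  suc n * 1          ≡⟨ cong (suc n *_) (nC0≡1 n) ⟨
  suc n * (n C 0)    ∎
  where open ≡-Reasoning
absorption zero    (suc k)
  rewrite k>n⇒nCk≡0 {1} {suc (suc k)} (s≤s (s≤s z≤n)) | k>n⇒nCk≡0 {0} {suc k} (s≤s z≤n)
  = *-zeroʳ k
absorption (suc n) (suc k) = begin
  suc (suc k) * (suc (suc n) C suc (suc k))
    ≡⟨ cong (suc (suc k) *_) (nCk+nC[k+1]≡[n+1]C[k+1] (suc n) (suc k)) ⟨
  suc (suc k) * (x + y)
    ≡⟨ solve 3 (λ k x y → (con 2 :+ k) :* (x :+ y)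
                        := x :+ ((con 1 :+ k) :* x :+ (con 2 :+ k) :* y)) refl k x y ⟩
  x + (suc k * x + suc (suc k) * y)
    ≡⟨ cong (_+_ x) (cong₂ _+_ (absorption n k) (absorption n (suc k))) ⟩
  x + (suc n * (n C k) + suc n * (n C suc k))
    ≡⟨ cong (_+_ x) (*-distribˡ-+ (suc n) (n C k) (n C suc k)) ⟨
  x + suc n * (n C k + n C suc k)
    ≡⟨ cong (λ z → x + suc n * z) (nCk+nC[k+1]≡[n+1]C[k+1] n k) ⟩
  suc (suc n) * x ∎
  where
  open ≡-Reasoning
  open +-*-Solver
  x = suc n C suc k
  y = suc n C suc (suc k)

-- Iterated differences

-- Degree d c g : the d-th difference of g is the constant c, and all lower
-- differences take natural values (so that subtraction is never needed).
data Degree : ℕ → ℕ → (ℕ → ℕ) → Set where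
  constant : (∀ s → g s ≡ c) → Degree 0 c g
  step     : (∀ s → g (suc s) ≡ g s + h s) → Degree d c h → Degree (suc d) c g

Degree-cong : (∀ s → h s ≡ g s) → Degree d c g → Degree d c h
Degree-cong h≗g (constant g≡c) = constant (λ s → trans (h≗g s) (g≡c s))
Degree-cong h≗g (step Δg D)    = step
  (λ s → trans (h≗g (suc s)) (trans (Δg s) (cong (_+ _) (sym (h≗g s))))) D

Degree-resp-≡ : ∀ {d′} → d ≡ d′ → c ≡ c′ → Degree d c g → Degree d′ c′ g
Degree-resp-≡ refl refl D = D

Degree-shift : ∀ a → Degree d c g → Degree d c (λ s → g (a + s))
Degree-shift         a (constant g≡c) = constant (λ s → g≡c (a + s))
Degree-shift {g = g} a (step Δg D)    =
  step (λ s → trans (cong g (+-suc a s)) (Δg (a + s))) (Degree-shift a D)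

Degree-zero : ∀ d → Degree d 0 (λ _ → 0)
Degree-zero zero    = constant (λ _ → refl)
Degree-zero (suc d) = step (λ _ → refl) (Degree-zero d)

Degree-+ : Degree d c g → Degree d c′ h → Degree d (c + c′) (λ s → g s + h s)
Degree-+ (constant g≡c) (constant h≡c) = constant (λ s → cong₂ _+_ (g≡c s) (h≡c s))
Degree-+ {g = g} {h = h} (step {h = g′} Δg D) (step {h = h′} Δh E) = step
  (λ s → trans (cong₂ _+_ (Δg s) (Δh s)) (interchange (g s) (g′ s) (h s) (h′ s)))
  (Degree-+ D E)
  where
  open +-*-Solver
  interchange : ∀ x y z w → (x + y) + (z + w) ≡ (x + z) + (y + w)
  interchange = solve 4 (λ x y z w → (x :+ y) :+ (z :+ w) := (x :+ z) :+ (y :+ w)) refl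

Degree-scale : ∀ a → Degree d c g → Degree d (a * c) (λ s → a * g s)
Degree-scale a (constant g≡c) = constant (λ s → cong (a *_) (g≡c s))
Degree-scale a (step Δg D)    =
  step (λ s → trans (cong (a *_) (Δg s)) (*-distribˡ-+ a _ _)) (Degree-scale a D)

-- Leibniz rule: the difference of `g s * h s` is `g′ s * h (suc s) + g s * h′ s`. Both summands
-- have degree one less, and Pascal's rule adds their top constants.
Degree-* : ∀ d d′ → Degree d c g → Degree d′ c′ h →
           Degree (d + d′) (((d + d′) C d) * (c * c′)) (λ s → g s * h s)
Degree-* {c = c} {c′ = c′} zero d′ (constant g≡c) E =
  Degree-resp-≡ refl (sym (trans (cong (_* (c * c′)) (nC0≡1 d′)) (*-identityˡ _)))
    (Degree-cong (λ s → cong (_* _) (g≡c s)) (Degree-scale c E))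
Degree-* {c = c} {g = g} {c′ = c′} d@(suc _) zero D (constant h≡c) =
  Degree-resp-≡ (sym (+-identityʳ d)) eq
    (Degree-cong (λ s → trans (cong (g s *_) (h≡c s)) (*-comm (g s) c′)) (Degree-scale c′ D))
  where
  open ≡-Reasoning
  eq : c′ * c ≡ ((d + 0) C d) * (c * c′)
  eq = begin
    c′ * c                    ≡⟨ *-comm c′ c ⟩
    c * c′                    ≡⟨ *-identityˡ _ ⟨
    1 * (c * c′)              ≡⟨ cong (_* (c * c′)) (nCn≡1 d) ⟨
    (d C d) * (c * c′)        ≡⟨ cong (λ i → (i C d) * (c * c′)) (+-identityʳ d) ⟨
    ((d + 0) C d) * (c * c′)  ∎
Degree-* {c = c} {g = g} {c′ = c′} {h = h}
         (suc d) (suc d′) D@(step {h = g′} Δg D′) E@(step {h = h′} Δh E′) =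
  step leibniz
    (Degree-resp-≡ refl eq
      (Degree-+ (Degree-* d (suc d′) D′ (Degree-shift 1 E))
        (Degree-resp-≡ (sym (+-suc d d′)) (cong (λ i → (i C suc d) * (c * c′)) (sym (+-suc d d′)))
          (Degree-* (suc d) d′ D E′))))
  where
  open ≡-Reasoning
  i = d + suc d′
  eq : (i C d) * (c * c′) + (i C suc d) * (c * c′) ≡ (suc i C suc d) * (c * c′)
  eq = trans (sym (*-distribʳ-+ (c * c′) (i C d) (i C suc d)))
             (cong (_* (c * c′)) (nCk+nC[k+1]≡[n+1]C[k+1] i d))
  leibniz : ∀ s → g (suc s) * h (suc s) ≡ g s * h s + (g′ s * h (suc s) + g s * h′ s)
  leibniz s rewrite Δg s | Δh s =
    solve 4 (λ x x′ y y′ → (x :+ x′) :* (y :+ y′)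
                         := x :* y :+ (x′ :* (y :+ y′) :+ x :* y′)) refl
      (g s) (g′ s) (h s) (h′ s)
    where open +-*-Solver

Degree-C : ∀ d → Degree d 1 (_C d)
Degree-C zero    = constant nC0≡1
Degree-C (suc d) = step
  (λ s → trans (sym (nCk+nC[k+1]≡[n+1]C[k+1] s d)) (+-comm (s C d) (s C suc d))) (Degree-C d)

-- A difference with step `a` is a sum of `a` shifted unit differences, each of degree `d` with
-- constant `c`.
Degree-increment : ∀ a → Degree (suc d) c g →
  ∃[ h ] (∀ s → g (a + s) ≡ g s + h s) × Degree d (a * c) h
Degree-increment {d = d}         zero    D           =
  (λ _ → 0) , (λ s → sym (+-identityʳ _)) , Degree-zero d
Degree-increment {g = g} (suc a) D@(step {h = g′} Δg D′)
  with h , g[a+_] , E ← Degree-increment a D =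
    (λ s → g′ (a + s) + h s) , eq , Degree-+ (Degree-shift a D′) E
  where
  eq : ∀ s → g (suc a + s) ≡ g s + (g′ (a + s) + h s)
  eq s rewrite Δg (a + s) | g[a+_] s =
    trans (+-assoc (g s) (h s) _) (cong (_+_ (g s)) (+-comm (h s) _))

-- Nonvanishing modulo a prime

∤-product : Prime p → ∀ a b → p ∤ a → p ∤ b → p ∤ a * b
∤-product p-prime a b p∤a p∤b = [ p∤a , p∤b ]′ ∘ euclidsLemma a b p-prime

-- Differencing with step `w x` uses up `x`: the degree drops by one and the constant gains the
-- factor `w x`, which is prime to `p`.
nonvanishing : ∀ {A : Set} → Prime p → (w : A → ℕ) (xs : List A) →
  All (λ x → p ∤ w x) xs → Degree (length xs) c g → p ∤ c →
  ∃[ ys ] ys ⊆ xs × p ∤ g (sum (map w ys))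
nonvanishing {p} p-prime w [] [] (constant g≡c) p∤c = [] , [] , p∤c ∘ subst (p ∣_) (g≡c 0)
nonvanishing {p} {c} {g} p-prime w (x ∷ xs) (p∤x ∷ p∤xs) D p∤c
  with h , g[x+_] , E ← Degree-increment (w x) D
  with ys , ys⊆xs , p∤h ← nonvanishing p-prime w xs p∤xs E (∤-product p-prime (w x) c p∤x p∤c)
  -- As `h s` is `g (w x + s)` minus `g s`, `p` cannot divide both values; this decides whether `x`
  -- joins the sublist.
  with p ∣? g (sum (map w ys))
... | no  p∤g = ys , x ∷ʳ ys⊆xs , p∤g
... | yes p∣g = x ∷ ys , refl ∷ ys⊆xs ,
  λ p∣g[x+s] → p∤h (∣m+n∣m⇒∣n (subst (p ∣_) (g[x+_] _) p∣g[x+s]) p∣g)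

-- Divisibility by prime powers

coprime-* : ∀ {a b k} → ℕ.Coprime a k → ℕ.Coprime b k → ℕ.Coprime (a * b) k
coprime-* a⊥k b⊥k (i∣ab , i∣k) =
  b⊥k (ℕ.coprime-divisor (λ (j∣i , j∣a) → a⊥k (j∣a , ∣-trans j∣i i∣k)) i∣ab , i∣k)

prime∤⇒coprime : ∀ {k} → Prime p → p ∤ k → ℕ.Coprime p k
prime∤⇒coprime p-prime p∤k (i∣p , i∣k) with prime⇒irreducible p-prime i∣p
... | inj₁ i≡1  = i≡1
... | inj₂ refl = contradiction i∣k p∤k

prime^∤⇒coprime : ∀ {k} → Prime p → ∀ e → p ∤ k → ℕ.Coprime (p ^ e) k
prime^∤⇒coprime {k = k} p-prime zero    p∤k = ℕ.1-coprimeTo k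
prime^∤⇒coprime p-prime (suc e) p∤k =
  coprime-* (prime∤⇒coprime p-prime p∤k) (prime^∤⇒coprime p-prime e p∤k)

prime≢1 : Prime p → p ≢ 1
prime≢1 p-prime refl = ¬prime[1] p-prime

module _ {e : ℕ} (p-prime : Prime p) (n≡p^e : suc m ≡ p ^ e) where

  -- With n = m + 1, absorption shows that n divides C(m + s, m) (n + s). A binomial coefficient
  -- prime to `p` is coprime to n and can be removed.
  p∤C[m+s,m]⇒n∣s : ∀ s → p ∤ ((m + s) C m) → suc m ∣ s
  p∤C[m+s,m]⇒n∣s s p∤C = ∣m+n∣m⇒∣n n∣n+s ∣-refl
    where
    n∣product : suc m ∣ ((m + s) C m) * (suc m + s)
    n∣product = divides (suc (m + s) C suc m)
      (trans (*-comm _ (suc m + s)) (trans (sym (absorption (m + s) m)) (*-comm (suc m) _)))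
    n∣n+s : suc m ∣ suc m + s
    n∣n+s = ℕ.coprime-divisor
      (subst (λ i → ℕ.Coprime i _) (sym n≡p^e) (prime^∤⇒coprime p-prime e p∤C)) n∣product

  -- For s > 0, absorption gives n C(s, n) = s C(s - 1, n - 1); if p n divides s, cancelling n
  -- leaves p dividing C(s, n). For s = 0 the coefficient vanishes.
  p∤C[s,n]⇒pn∤s : ∀ s → p ∤ (s C suc m) → p * suc m ∤ s
  p∤C[s,n]⇒pn∤s zero    p∤C _ =
    p∤C (subst (p ∣_) (sym (k>n⇒nCk≡0 {0} {suc m} (s≤s z≤n))) (p ∣0))
  p∤C[s,n]⇒pn∤s (suc s) p∤C pn∣s = p∤C (*-cancelˡ-∣ (suc m)
    (subst₂ _∣_ (*-comm p (suc m)) (sym (absorption s m)) (∣-trans pn∣s (m∣m*n (s C m)))))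

  -- The hockey-stick sum Σ_{t ≤ s} C(t + m, m), in which p divides all terms
  -- except the first.
  C[s+n,n]≡1 : ∀ s → s < suc m → ∃[ t ] (s + suc m) C suc m ≡ t * p + 1
  C[s+n,n]≡1 zero    _     = 0 , nCn≡1 (suc m)
  C[s+n,n]≡1 (suc s) s+1<n
    with t , eq ← C[s+n,n]≡1 s (<-trans (n<1+n s) s+1<n)
    with p ∣? ((m + suc s) C m)
  ... | no  p∤C = contradiction (p∤C[m+s,m]⇒n∣s (suc s) p∤C) (>⇒∤ s+1<n)
  ... | yes (divides q eq′) = q + t , (begin
    (suc s + suc m) C suc m                       ≡⟨ nCk+nC[k+1]≡[n+1]C[k+1] (s + suc m) m ⟨
    ((s + suc m) C m) + ((s + suc m) C suc m)
      ≡⟨ cong₂ _+_ (trans (cong (_C m) s+n≡m+[1+s]) eq′) eq ⟩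
    q * p + (t * p + 1)                           ≡⟨ +-assoc (q * p) (t * p) 1 ⟨
    q * p + t * p + 1                             ≡⟨ cong (_+ 1) (*-distribʳ-+ p q t) ⟨
    (q + t) * p + 1                               ∎)
    where
    open ≡-Reasoning
    s+n≡m+[1+s] : s + suc m ≡ m + suc s
    s+n≡m+[1+s] = trans (+-suc s m) (trans (cong suc (+-comm s m)) (sym (+-suc m s)))

  -- By symmetry this is C(2n - 1, n), which is 1 modulo `p` by the case s = n - 1 of `C[s+n,n]≡1`.
  p∤C[m+n,m] : p ∤ ((m + suc m) C m)
  p∤C[m+n,m] p∣C with t , eq ← C[s+n,n]≡1 m (n<1+n m) =
    prime≢1 p-prime (∣1⇒≡1 (∣m+n∣m⇒∣n (subst (p ∣_) C≡tp+1 p∣C) (n∣m*n t)))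
    where
    C≡tp+1 : (m + suc m) C m ≡ t * p + 1
    C≡tp+1 = trans (nCk≡nC[n∸k] (m≤m+n m (suc m)))
                   (trans (cong ((m + suc m) C_) (m+n∸m≡n m (suc m))) eq)

  -- The weight `w` will be reduction modulo n²: the sublist consists of integers, while the
  -- binomial coefficients are evaluated at sums of natural residues.
  ∃-subsum : ∀ {A : Set} (w : A → ℕ) (xs : List A) → All (λ x → p ∤ w x) xs →
    length xs ≡ m + suc m →
    ∃[ ys ] ys ⊆ xs × suc m ∣ sum (map w ys) × p * suc m ∤ sum (map w ys)
  ∃-subsum w xs p∤xs |xs|≡m+n
    with ys , ys⊆xs , p∤f ← nonvanishing p-prime w xs p∤xs
           (Degree-resp-≡ (sym |xs|≡m+n) refl
             (Degree-* m (suc m) (Degree-shift m (Degree-C m)) (Degree-C (suc m))))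
           (p∤C[m+n,m] ∘ subst (p ∣_) (*-identityʳ _)) =
    let s = sum (map w ys) in
    ys , ys⊆xs ,
    p∤C[m+s,m]⇒n∣s s (λ p∣C → p∤f (∣-trans p∣C (m∣m*n (s C suc m)))) ,
    p∤C[s,n]⇒pn∤s s (λ p∣C → p∤f (∣-trans p∣C (n∣m*n ((m + s) C m))))

-- Sums of integers

sumℤ-++ : ∀ xs ys → sumℤ (xs ++ ys) ≡ sumℤ xs ℤ.+ sumℤ ys
sumℤ-++ []       ys = sym (ℤ.+-identityˡ _)
sumℤ-++ (x ∷ xs) ys = trans (cong (ℤ._+_ x) (sumℤ-++ xs ys)) (sym (ℤ.+-assoc x _ _))

%ℕ-≡⇒∣ : ∀ n .{{_ : NonZero n}} a b → a %ℕ n ≡ (a ℤ.+ b) %ℕ n → + n ℤ∣.∣ b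
%ℕ-≡⇒∣ n a b eq = ℤ∣.divides ((a ℤ.+ b) /ℕ n ℤ.- a /ℕ n) (begin
  b
    ≡⟨ b≡[a+b]-a a b ⟩
  (a ℤ.+ b) ℤ.- a
    ≡⟨ cong₂ ℤ._-_ (a≡a%ℕn+[a/ℕn]*n (a ℤ.+ b) n) (a≡a%ℕn+[a/ℕn]*n a n) ⟩
  (+ ((a ℤ.+ b) %ℕ n) ℤ.+ q′ ℤ.* + n) ℤ.- (+ (a %ℕ n) ℤ.+ q ℤ.* + n)
    ≡⟨ cong (λ r → (+ r ℤ.+ q′ ℤ.* + n) ℤ.- (+ (a %ℕ n) ℤ.+ q ℤ.* + n)) eq ⟨
  (+ (a %ℕ n) ℤ.+ q′ ℤ.* + n) ℤ.- (+ (a %ℕ n) ℤ.+ q ℤ.* + n)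
    ≡⟨ cancel (+ (a %ℕ n)) q q′ (+ n) ⟩
  (q′ ℤ.- q) ℤ.* + n ∎)
  where
  open ≡-Reasoning
  open ℤSolver.+-*-Solver
  q  = a /ℕ n
  q′ = (a ℤ.+ b) /ℕ n
  b≡[a+b]-a : ∀ a b → b ≡ (a ℤ.+ b) ℤ.- a
  b≡[a+b]-a = solve 2 (λ a b → b := (a :+ b) :- a) refl
  cancel : ∀ r q q′ n → (r ℤ.+ q′ ℤ.* n) ℤ.- (r ℤ.+ q ℤ.* n) ≡ (q′ ℤ.- q) ℤ.* n
  cancel = solve 4 (λ r q q′ n → (r :+ q′ :* n) :- (r :+ q :* n) := (q′ :- q) :* n) refl

-- Carries divisibility properties of sums of residues back to the integers themselves.
sumℤ-%ℕ : ∀ n .{{_ : NonZero n}} xs →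
          ∃[ q ] sumℤ xs ≡ + sum (map (_%ℕ n) xs) ℤ.+ q ℤ.* + n
sumℤ-%ℕ n []       = 0ℤ , refl
sumℤ-%ℕ n (x ∷ xs) with q , eq ← sumℤ-%ℕ n xs = x /ℕ n ℤ.+ q , (begin
  x ℤ.+ sumℤ xs
    ≡⟨ cong₂ ℤ._+_ (a≡a%ℕn+[a/ℕn]*n x n) eq ⟩
  (+ (x %ℕ n) ℤ.+ x /ℕ n ℤ.* + n) ℤ.+ (+ s ℤ.+ q ℤ.* + n)
    ≡⟨ solve 5 (λ r q r′ q′ n → (r :+ q :* n) :+ (r′ :+ q′ :* n)
                              := (r :+ r′) :+ (q :+ q′) :* n) refl
         (+ (x %ℕ n)) (x /ℕ n) (+ s) q (+ n) ⟩
  (+ (x %ℕ n) ℤ.+ + s) ℤ.+ (x /ℕ n ℤ.+ q) ℤ.* + n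
    ≡⟨ cong (ℤ._+ (x /ℕ n ℤ.+ q) ℤ.* + n) (ℤ.pos-+ (x %ℕ n) s) ⟨
  + (x %ℕ n + s) ℤ.+ (x /ℕ n ℤ.+ q) ℤ.* + n ∎)
  where
  open ≡-Reasoning
  open ℤSolver.+-*-Solver
  s = sum (map (_%ℕ n) xs)

-- Among the n + 1 prefixes of lengths 0 to n, two have sums congruent modulo n; the block is what
-- the longer one adds to the shorter.
zero-sum-block : ∀ n .{{_ : NonZero n}} xs → n ≤ length xs →
  ∃[ us ] ∃[ vs ] ∃[ ws ] xs ≡ us ++ vs ++ ws ×
    1 ≤ length vs × length vs ≤ n × + n ℤ∣.∣ sumℤ vs
zero-sum-block n xs n≤|xs|
  with i , j , i<j , eq ← pigeonhole (n<1+n n)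
         (λ (k : Fin (suc n)) → fromℕ< (n%ℕd<d (sumℤ (take (toℕ k) xs)) n)) =
    take i′ xs , vs , drop j′ xs , split , |vs|≥1 , |vs|≤n ,
    %ℕ-≡⇒∣ n (sumℤ (take i′ xs)) (sumℤ vs)
      (trans (fromℕ<-injective _ _ _ _ eq) (cong (_%ℕ n)
        (trans (cong sumℤ (sym prefix)) (sumℤ-++ (take i′ xs) vs))))
  where
  i′ = toℕ i
  j′ = toℕ j
  vs = drop i′ (take j′ xs)
  prefix : take i′ xs ++ vs ≡ take j′ xs
  prefix = trans
    (cong (_++ vs) (trans (cong (λ k → take k xs) (sym (m≤n⇒m⊓n≡m (<⇒≤ i<j))))
                          (sym (take-take i′ j′ xs))))
    (take++drop≡id i′ (take j′ xs))
  split : xs ≡ take i′ xs ++ vs ++ drop j′ xs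
  split = trans (sym (take++drop≡id j′ xs))
    (trans (cong (_++ drop j′ xs) (sym prefix)) (++-assoc (take i′ xs) vs (drop j′ xs)))
  j≤n : j′ ≤ n
  j≤n = s≤s⁻¹ (toℕ<n j)
  |vs|≡j∸i : length vs ≡ j′ ∸ i′
  |vs|≡j∸i = trans (length-drop i′ (take j′ xs))
    (cong (_∸ i′) (trans (length-take j′ xs) (m≤n⇒m⊓n≡m (≤-trans j≤n n≤|xs|))))
  |vs|≥1 : 1 ≤ length vs
  |vs|≥1 = subst (1 ≤_) (sym |vs|≡j∸i) (m<n⇒0<n∸m i<j)
  |vs|≤n : length vs ≤ n
  |vs|≤n = subst (_≤ n) (sym |vs|≡j∸i) (≤-trans (m∸n≤m j′ i′) j≤n)

-- Exact divisibility and short subsums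

-- When `n` is a power of the prime `p`, this says that σ has the same p-adic valuation as `n`. In
-- this form the gcd condition passes easily to complements of blocks.
Exact : ℕ → ℕ → ℤ → Set
Exact p n σ = + n ℤ∣.∣ σ × ¬ (+ (p * n) ℤ∣.∣ σ)

exact⇒nonempty : ∀ ys → Exact p n (sumℤ ys) → 1 ≤ length ys
exact⇒nonempty {p} {n} []      (_ , pn∤0) = ⊥-elim (pn∤0 (ℤ∣.∣ᵤ⇒∣ ((p * n) ∣0)))
exact⇒nonempty         (_ ∷ _) _          = s≤s z≤n

exact-split : ∀ {a b} → + n ℤ∣.∣ a → + (p * n) ℤ∣.∣ a → Exact p n (a ℤ.+ b) → Exact p n b
exact-split n∣a pn∣a (n∣a+b , pn∤a+b) =
  ℤ∣.∣m+n∣m⇒∣n n∣a+b n∣a , λ pn∣b → pn∤a+b (ℤ∣.∣m∣n⇒∣m+n pn∣a pn∣b)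

-- The bound `k` on the length drives the recursion, because deleting a block from the middle of
-- `ys` is not a structural descent.
∃-short-exact : ∀ .{{_ : NonZero n}} k ys → length ys ≤ k → Exact p n (sumℤ ys) →
  ∃[ zs ] zs ⊆ ys × length zs ≤ n × Exact p n (sumℤ zs)
∃-short-exact {n} {p} k ys |ys|≤k exact with ≤-<-connex (length ys) n
... | inj₁ |ys|≤n = ys , ⊆-refl , |ys|≤n , exact
... | inj₂ n<|ys|
  with us , vs , ws , refl , |vs|≥1 , |vs|≤n , n∣vs ← zero-sum-block n ys (<⇒≤ n<|ys|)
  with + (p * n) ℤ∣.∣? sumℤ vs
... | no pn∤vs = vs , ++⁺ˡ us (++⁺ʳ ws ⊆-refl) , |vs|≤n , n∣vs , pn∤vs
-- Deleting the block changes the sum by a multiple of p n, so exactness survives, and the list gets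
-- shorter because the block is nonempty.
... | yes pn∣vs = go k |ys|≤k
  where
  sum≡ : sumℤ (us ++ vs ++ ws) ≡ sumℤ vs ℤ.+ sumℤ (us ++ ws)
  sum≡ rewrite sumℤ-++ us (vs ++ ws) | sumℤ-++ vs ws | sumℤ-++ us ws =
    solve 3 (λ u v w → u :+ (v :+ w) := v :+ (u :+ w)) refl (sumℤ us) (sumℤ vs) (sumℤ ws)
    where open ℤSolver.+-*-Solver
  length≡ : length (us ++ vs ++ ws) ≡ length vs + length (us ++ ws)
  length≡ rewrite length-++ us {vs ++ ws} | length-++ vs {ws} | length-++ us {ws} =
    solve 3 (λ u v w → u :+ (v :+ w) := v :+ (u :+ w)) refl (length us) (length vs) (length ws)
    where open +-*-Solver
  shorter : length (us ++ ws) < length (us ++ vs ++ ws)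
  shorter = subst (length (us ++ ws) <_) (sym length≡) (+-monoˡ-≤ (length (us ++ ws)) |vs|≥1)
  go : ∀ k → length (us ++ vs ++ ws) ≤ k →
       ∃[ zs ] zs ⊆ us ++ vs ++ ws × length zs ≤ n × Exact p n (sumℤ zs)
  go zero    |ys|≤0 = contradiction (<-≤-trans shorter |ys|≤0) n≮0
  go (suc k) |ys|≤k
    with zs , zs⊆ , rest ← ∃-short-exact {p = p} k (us ++ ws) (s≤s⁻¹ (<-≤-trans shorter |ys|≤k))
           (exact-split {p = p} n∣vs pn∣vs (subst (Exact p n) sum≡ exact)) =
    zs , ⊆-trans zs⊆ (++⁺ {as = us} ⊆-refl (++⁺ˡ vs ⊆-refl)) , rest

-- Because of this, an upper bound for η and a lower bound for D settle both constants.
η⇒D : ∀ {n ℓ} → ηProperty n ℓ → DProperty n ℓ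
η⇒D η xs |xs|≡ℓ coprime with ys , ys⊆xs , nonempty , _ , good ← η xs |xs|≡ℓ coprime =
  ys , ys⊆xs , nonempty , good

-- Writing |σ| = q n, the gcd is n gcd(q, n), and `p` does not divide q since p n does not divide σ.
exact⇒gcd : ∀ e {σ} .{{_ : NonZero n}} → Prime p → n ≡ p ^ e → Exact p n σ →
            ℕ.gcd ∣ σ ∣ (n ^ 2) ≡ n
exact⇒gcd {n} {p} e {σ} p-prime n≡p^e (n∣σ , pn∤σ) with ℤ∣.∣⇒∣ᵤ n∣σ
... | divides q |σ|≡qn = begin
  ℕ.gcd ∣ σ ∣ (n ^ 2)        ≡⟨ cong₂ ℕ.gcd (trans |σ|≡qn (*-comm q n)) (cong (n *_) (*-identityʳ n)) ⟩
  ℕ.gcd (n * q) (n * n)      ≡⟨ ℕ.c*gcd[m,n]≡gcd[cm,cn] n q n ⟨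
  n * ℕ.gcd q n              ≡⟨ cong (n *_) (ℕ.coprime⇒gcd≡1 q⊥n) ⟩
  n * 1                      ≡⟨ *-identityʳ n ⟩
  n                          ∎
  where
  open ≡-Reasoning
  p∤q : p ∤ q
  p∤q (divides r refl) = pn∤σ (ℤ∣.∣ᵤ⇒∣ (divides r (trans |σ|≡qn (*-assoc r p n))))
  q⊥n : ℕ.Coprime q n
  q⊥n = ℕ.sym (subst (λ k → ℕ.Coprime k q) (sym n≡p^e) (prime^∤⇒coprime p-prime e p∤q))

-- The upper bound for η

η-upper : ∀ e → Prime p → 1 ≤ e → suc m ≡ p ^ e → ηProperty (suc m) (m + suc m)
η-upper {p} {m} (suc e) p-prime _ n≡p^e xs |xs|≡ coprime =
  let ys , ys⊆xs , n∣s , pn∤s =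
        ∃-subsum {e = suc e} p-prime n≡p^e (_%ℕ N) xs (All.map (λ {x} → p∤residue {x}) coprime) |xs|≡
      q , σ≡s+qN = sumℤ-%ℕ N ys
      zs , zs⊆ys , |zs|≤n , exact =
        ∃-short-exact {p = p} (length ys) ys ≤-refl (exact-residue {q = q} n∣s pn∤s σ≡s+qN)
  in zs , ⊆-trans zs⊆ys ys⊆xs , exact⇒nonempty {p} zs exact , |zs|≤n ,
     cong +_ (exact⇒gcd (suc e) {sumℤ zs} p-prime n≡p^e exact)
  where
  -- Modulo n², residues still detect divisibility by p n, since `p` divides n; modulo n this would
  -- be lost.
  N = suc m * suc m
  p∣n : p ∣ suc m
  p∣n = subst (p ∣_) (sym n≡p^e) (m∣m*n (p ^ e))
  pn∣N : p * suc m ∣ N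
  pn∣N = subst (_∣ N) (*-comm (suc m) p) (*-monoʳ-∣ (suc m) p∣n)
  p∤residue : ∀ {x} → Coprime x (+ suc m) → p ∤ x %ℕ N
  p∤residue {x} x⊥n p∣r = prime≢1 p-prime (x⊥n (ℤ∣.∣⇒∣ᵤ p∣x , p∣n))
    where
    p∣x : + p ℤ∣.∣ x
    p∣x = subst (+ p ℤ∣.∣_) (sym (a≡a%ℕn+[a/ℕn]*n x N))
      (ℤ∣.∣m∣n⇒∣m+n {m = + (x %ℕ N)} (ℤ∣.∣ᵤ⇒∣ p∣r)
        (ℤ∣.∣n⇒∣m*n (x /ℕ N) {+ N} (ℤ∣.∣ᵤ⇒∣ (∣-trans p∣n (m∣m*n (suc m))))))
  exact-residue : ∀ {s q σ} → suc m ∣ s → p * suc m ∤ s → σ ≡ + s ℤ.+ q ℤ.* + N →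
                  Exact p (suc m) σ
  exact-residue {s} {q} n∣s pn∤s refl =
    ℤ∣.∣m∣n⇒∣m+n {m = + s} (ℤ∣.∣ᵤ⇒∣ n∣s) (ℤ∣.∣n⇒∣m*n q {+ N} (ℤ∣.∣ᵤ⇒∣ (m∣m*n (suc m)))) ,
    λ pn∣σ → pn∤s (ℤ∣.∣⇒∣ᵤ (ℤ∣.∣m+n∣n⇒∣m {m = + s} pn∣σ (ℤ∣.∣n⇒∣m*n q {+ N} (ℤ∣.∣ᵤ⇒∣ pn∣N))))

-- The lower bound for D

signs : ℕ → ℕ → List ℤ
signs a b = replicate a 1ℤ ++ replicate b -1ℤ

-- Here `i` and `j` count the selected ones and minus ones, so the absolute value of the sum is at
-- most the larger of `a` and `b`.
sumℤ-⊆-signs : ∀ a b {ys} → ys ⊆ signs a b →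
               ∃[ i ] ∃[ j ] i ≤ a × j ≤ b × sumℤ ys ≡ i ⊖ j
sumℤ-⊆-signs zero    zero    []          = 0 , 0 , z≤n , z≤n , refl
sumℤ-⊆-signs zero    (suc b) (_ ∷ʳ τ)
  with i , j , i≤a , j≤b , eq ← sumℤ-⊆-signs zero b τ = i , j , i≤a , m≤n⇒m≤1+n j≤b , eq
sumℤ-⊆-signs zero    (suc b) (refl ∷ τ)
  with i , j , i≤a , j≤b , eq ← sumℤ-⊆-signs zero b τ =
  i , suc j , i≤a , s≤s j≤b , trans (cong (ℤ._+_ -1ℤ) eq) (ℤ.distribʳ-⊖-+-neg 0 i j)
sumℤ-⊆-signs (suc a) b       (_ ∷ʳ τ)
  with i , j , i≤a , j≤b , eq ← sumℤ-⊆-signs a b τ = i , j , m≤n⇒m≤1+n i≤a , j≤b , eq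
sumℤ-⊆-signs (suc a) b       (refl ∷ τ)
  with i , j , i≤a , j≤b , eq ← sumℤ-⊆-signs a b τ =
  suc i , j , s≤s i≤a , j≤b , trans (cong (ℤ._+_ 1ℤ) eq) (ℤ.distribʳ-⊖-+-pos 1 i j)

coprime-signs : ∀ a b n → All (λ x → Coprime x (+ n)) (signs a b)
coprime-signs a b n =
  All.++⁺ (All.replicate⁺ a (ℕ.1-coprimeTo n)) (All.replicate⁺ b (ℕ.1-coprimeTo n))

-- For k = 0 the gcd is n², which exceeds n; for k > 0 it divides k and so is less than n.
small⇒¬gcd : ∀ {k} → 1 < n → k < n → ℕ.gcd k (n ^ 2) ≢ n
small⇒¬gcd {n} {zero}  1<n k<n gcd≡n =
  <⇒≢ (m<m*n n (n * 1) {{>-nonZero (<⇒≤ 1<n)}} (subst (1 <_) (sym (*-identityʳ n)) 1<n))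
      (trans (sym gcd≡n) (ℕ.gcd-identityˡ (n ^ 2)))
small⇒¬gcd {n} {suc k} 1<n k<n gcd≡n =
  <⇒≱ k<n (∣⇒≤ (subst (_∣ suc k) gcd≡n (ℕ.gcd[m,n]∣m (suc k) (n ^ 2))))

D-lower : ∀ {ℓ} → 0 < m → DProperty (suc m) ℓ → m + suc m ≤ ℓ
D-lower {m} {ℓ} 0<m D = ≮⇒≥ λ ℓ<2m+1 →
  -- A counterexample of length exactly `ℓ`: ones are used up to `m` of them, and the remaining
  -- places, again at most `m`, hold minus ones.
  let a = m ⊓ ℓ
      b = ℓ ∸ m
      |signs|≡ℓ : length (signs a b) ≡ ℓ
      |signs|≡ℓ = trans (length-++ (replicate a 1ℤ))
        (trans (cong₂ _+_ (length-replicate a) (length-replicate b)) (m⊓n+n∸m≡n m ℓ))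
      ys , ys⊆ , _ , good = D (signs a b) |signs|≡ℓ (coprime-signs a b (suc m))
      i , j , i≤a , j≤b , σ≡i⊖j = sumℤ-⊆-signs a b ys⊆
      b≤m : b ≤ m
      b≤m = m≤n+o⇒m∸n≤o ℓ m (s≤s⁻¹ (subst (ℓ <_) (+-suc m m) ℓ<2m+1))
      |σ|≤m : ∣ sumℤ ys ∣ ≤ m
      |σ|≤m = subst (_≤ m) (cong ∣_∣ (sym σ≡i⊖j))
        (≤-trans (ℤ.∣m⊝n∣≤m⊔n i j)
          (⊔-lub (≤-trans i≤a (m⊓n≤m m ℓ)) (≤-trans j≤b b≤m)))
  in small⇒¬gcd (s≤s 0<m) (s≤s |σ|≤m) (ℤ.+-injective good)

theorem1p4 : ∀ (n : ℕ) → PrimePower n →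
    (D×[ n ]≡ (2 * n ∸ 1)) × (η×[ n ]≡ (2 * n ∸ 1))
theorem1p4 zero    (p , e , p-prime , _ , 0≡p^e) =
  contradiction (sym 0≡p^e) (≢-nonZero⁻¹ (p ^ e) {{m^n≢0 p e {{prime⇒nonZero p-prime}}}})
theorem1p4 (suc m) (p , e , p-prime , 1≤e , n≡p^e)
  -- The bound `2 * suc m ∸ 1` computes to `m + suc (m + 0)`.
  rewrite +-identityʳ m =
    (m+n>0 , η⇒D η-holds , λ _ _ → D-lower 0<m) ,
    (m+n>0 , η-holds , λ _ _ → D-lower 0<m ∘ η⇒D)
  where
  m+n>0 : 1 ≤ m + suc m
  m+n>0 = m≤n⇒m≤o+n m (s≤s z≤n)
  0<m : 0 < m
  0<m = s≤s⁻¹ (subst (1 <_) (sym n≡p^e)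
    (^-monoʳ-< p (nonTrivial⇒n>1 p {{prime⇒nonTrivial p-prime}}) 1≤e))
  η-holds : ηProperty (suc m) (m + suc m)
  η-holds = η-upper e p-prime 1≤e n≡p^e
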